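{- Let $G=(V,E)$ be a simple graph with $n=|V|$ vertices and let $f:V\to\mathbb{Z}_{\ge 0}$. Let $M$ be the $f$-matching of $G$ at some point in the execution of the high-level blocking set algorithm, and let $s$ be the length of a shortest augmenting trail for $M$. Then any $f$-matching of $G$ has at most $4(n/s)^2$ more edges than $M$.
   Context: Graphs are finite and undirected. Loops are allowed, even in simple graphs (a simple graph has no two parallel edges); a loop at $v$ contributes 2 to the degree of $v$. An $f$-matching is a set $M$ of edges such that every vertex $v$ has degree at most $f(v)$ in $M$; $v$ is free if the inequality is strict. An edge is matched if it is in $M$, else unmatched. A trail is a path that may repeat vertices but not edges; its length is its number of edges. A trail is alternating if every two consecutive edges consist of one matched and one unmatched edge (for a closed trail the first and last edges are not considered consecutive). An augmenting trail $A$ for $M$ is an alternating trail that begins and ends at a free vertex (possibly the same vertex), with first and last edges unmatched, such that $M\oplus A$ (symmetric difference) is again an $f$-matching. A shortest augmenting trail is an augmenting trail for $M$ of minimum possible length. A blocking set for $M$ is a maximal collection of edge-disjoint shortest augmenting trails for $M$. The high-level algorithm maintains an $f$-matching and repeatedly finds a blocking set and augments each of its trails (replacing $M$ by its symmetric difference with the trails), halting when no augmenting trail exists. -}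

module Defs where

open import Data.Fin.Base using (Fin)
open import Data.Fin.Properties using (_≟_)
open import Data.Fin.Subset using (Subset; _∈_; _∉_; _∩_; _∪_; _─_; ⋃; ⁅_⁆; ∣_∣)
open import Data.List.Base using (List; []; _∷_; foldl; head; last; length; map)
open import Data.List.Relation.Binary.Disjoint.Propositional using (Disjoint)
open import Data.List.Relation.Binary.Subset.Propositional using (_⊆_)
open import Data.List.Relation.Unary.All using (All)
open import Data.List.Relation.Unary.AllPairs using (AllPairs)
open import Data.List.Relation.Unary.Linked using (Linked)
open import Data.List.Relation.Unary.Unique.Propositional using (Unique)
open import Data.Maybe.Relation.Unary.Any as Maybe using ()
open import Data.Nat.Base using (ℕ; _+_; _≤_; _<_; NonZero)
open import Data.Product.Base using (∃; _×_; _,_)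
open import Data.Sum.Base using (_⊎_)
open import Data.Vec.Base using (tabulate)
open import Relation.Binary.Construct.Closure.ReflexiveTransitive using (Star)
open import Relation.Binary.PropositionalEquality using (_≡_)
open import Relation.Nullary.Decidable using (⌊_⌋)

-- A finite undirected multigraph, loops allowed.  The two ends of an edge are
-- stored in an arbitrary order, which nothing below depends on.
record Graph : Set where
  field
    ∣V∣ ∣E∣   : ℕ
    end₁ end₂ : Fin ∣E∣ → Fin ∣V∣

  Vertex = Fin ∣V∣
  Edge   = Fin ∣E∣
  Edges  = Subset ∣E∣

  Joins : Edge → Vertex → Vertex → Set
  Joins e u v = (end₁ e ≡ u × end₂ e ≡ v) ⊎ (end₁ e ≡ v × end₂ e ≡ u)

  -- Loops are allowed, but two loops at the same vertex are parallel.
  Simple : Set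
  Simple = ∀ {e e′ u v} → Joins e u v → Joins e′ u v → e ≡ e′

  -- A loop at v is counted once in each summand, hence twice.
  degree : Edges → Vertex → ℕ
  degree S v = ∣ S ∩ tabulate (λ e → ⌊ end₁ e ≟ v ⌋) ∣
             + ∣ S ∩ tabulate (λ e → ⌊ end₂ e ≟ v ⌋) ∣

  infixl 6 _⊕_
  _⊕_ : Edges → Edges → Edges
  S ⊕ T = (S ─ T) ∪ (T ─ S)

  infixr 5 _∷⟨_⟩_
  data Walk : Vertex → Vertex → Set where
    []      : ∀ {v} → Walk v v
    _∷⟨_⟩_ : ∀ {u v w} (e : Edge) → Joins e u v → Walk v w → Walk u w

  walkEdges : ∀ {u v} → Walk u v → List Edge
  walkEdges []             = []
  walkEdges (e ∷⟨ _ ⟩ p) = e ∷ walkEdges p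

  record Trail : Set where
    field
      start finish : Vertex
      walk         : Walk start finish
      unique       : Unique (walkEdges walk)

    edges : List Edge
    edges = walkEdges walk

    edgeSet : Edges
    edgeSet = ⋃ (map ⁅_⁆ edges)

    len : ℕ
    len = length edges

  open Trail

  EdgeDisjoint : Trail → Trail → Set
  EdgeDisjoint A B = Disjoint (edges A) (edges B)

  -- `Linked` relates list neighbours only, so the first and last edges of a
  -- closed trail are not regarded as consecutive.
  Alternating : Edges → Trail → Set
  Alternating M A =
    Linked (λ e e′ → (e ∈ M × e′ ∉ M) ⊎ (e ∉ M × e′ ∈ M)) (edges A)

  augmentAll : Edges → List Trail → Edges
  augmentAll = foldl (λ M A → M ⊕ edgeSet A)

  module Matching (f : Vertex → ℕ) where

    IsMatching : Edges → Set
    IsMatching M = ∀ v → degree M v ≤ f v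

    Free : Edges → Vertex → Set
    Free M v = degree M v < f v

    record IsAugmenting (M : Edges) (A : Trail) : Set where
      field
        alternating    : Alternating M A
        startFree      : Free M (start A)
        finishFree     : Free M (finish A)
        firstUnmatched : Maybe.Any (_∉ M) (head (edges A))
        lastUnmatched  : Maybe.Any (_∉ M) (last (edges A))
        augmented      : IsMatching (M ⊕ edgeSet A)

    record IsShortestAugmenting (M : Edges) (A : Trail) : Set where
      field
        augmenting : IsAugmenting M A
        minimal    : ∀ B → IsAugmenting M B → len A ≤ len B

    -- Edge-disjoint augmenting trails may compete for the same free vertex:
    -- two trails ending at v need f v to exceed the degree of v by 2.  The last
    -- field makes it possible to augment all trails of a collection.
    record IsCollection (M : Edges) (As : List Trail) : Set where
      field
        shortest  : All (IsShortestAugmenting M) As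
        disjoint  : AllPairs EdgeDisjoint As
        augmented : IsMatching (augmentAll M As)

    record IsBlocking (M : Edges) (As : List Trail) : Set where
      field
        collection : IsCollection M As
        maximal    : ∀ Bs → IsCollection M Bs → As ⊆ Bs → Bs ⊆ As

    -- One round of the algorithm, which halts if there is no augmenting trail.
    data Round (M : Edges) : Edges → Set where
      round : ∃ (IsAugmenting M) → ∀ As → IsBlocking M As →
              Round M (augmentAll M As)

    -- The algorithm may be started from any f-matching.
    Reached : Edges → Set
    Reached M = ∃ λ M₀ → IsMatching M₀ × Star Round M₀ M

    len-nonZero : ∀ {M A} → IsShortestAugmenting M A → NonZero (len A)
    len-nonZero {M} {A} short = go (edges A) firstUnmatched
      where
      open IsShortestAugmenting short
      open IsAugmenting augmenting
      go : ∀ es → Maybe.Any (_∉ M) (head es) → NonZero (length es)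
      go (_ ∷ _) _ = _

{-# OPTIONS --safe #-}
-- Let k = |N| − |M|, and orient the edges in which M and N differ, ignoring the
-- matching, so that at every vertex in- and out-degree differ by at most one.
-- Give every vertex two states, according to whether the next edge to be used
-- is matched; an oriented edge is then an arc between states, and directed
-- paths are alternating.  Since the two states of a vertex v have excesses with
-- sum at most one in absolute value and with difference deg_N v − deg_M v, a
-- directed path from an unmatched-next state of positive excess to a
-- matched-next state of negative excess joins two free vertices and augments M.
-- No edge has both directions, so blossoms do not arise: a path that visits no
-- state twice is a trail, and it has at least s edges.  Layer the states by
-- their distance to those of the second kind.  At least k arcs enter each of
-- the first s distance balls, and as G is simple there are at most
-- |Lⱼ₊₁| · |Lⱼ| of them.  The layers contain at most 2n states altogether, which
-- gives k s² ≤ 4 n².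
module Submission where

open import Defs
open import Data.Bool.Base using (Bool; true; false; not; _∧_; _∨_; _xor_)
import Data.Bool.Properties as Boolₚ
open import Data.Fin.Base using (Fin; zero; suc)
import Data.Fin.Properties as Finₚ
open import Data.Fin.Subset as Subset using (Subset; ∣_∣; ⁅_⁆; ⋃; _∩_; _∪_; _─_)
open import Data.Integer.Base using (+_)
import Data.Integer.Properties as ℤₚ
import Data.Integer.Tactic.RingSolver as ℤ-Solver
open import Data.List.Base as List using (List; []; _∷_; _++_; map; filter; length; allFin; tabulate; cartesianProduct)
import Data.List.Properties as Listₚ
open import Data.List.Membership.Propositional using (_∈_; _∉_; find; lose)
open import Data.List.Membership.Propositional.Properties
  using (∈-∃++; ∈-++⁺ˡ; ∈-++⁺ʳ; ∈-++⁻; ∈-filter⁺; ∈-filter⁻; ∈-map⁺; ∈-map⁻; ∈-allFin; ∈-cartesianProduct⁺)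
open import Data.List.Relation.Binary.Pointwise.Base using (Pointwise; []; _∷_)
open import Data.List.Relation.Unary.All as All using (All; []; _∷_)
import Data.List.Relation.Unary.All.Properties as Allₚ
open import Data.List.Relation.Unary.AllPairs as AllPairs using ([]; _∷_)
import Data.List.Relation.Unary.AllPairs.Properties as AllPairsₚ
open import Data.List.Relation.Unary.Any using (Any; here; there; any?)
open import Data.List.Relation.Unary.Linked using (Linked; []; [-]; _∷_)
open import Data.List.Relation.Unary.Unique.Propositional using (Unique)
import Data.List.Relation.Unary.Unique.Propositional.Properties as Uniqueₚ
open import Data.Maybe.Relation.Unary.Any as Maybe using (just)
open import Data.Nat.Base as ℕ using (ℕ; zero; suc; NonZero; z≤n; s≤s)
import Data.Nat.Properties as ℕₚ
import Data.Nat.Tactic.RingSolver as ℕ-Solver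
open import Data.Product.Base using (∃; ∃₂; _×_; _,_; proj₁; proj₂)
import Data.Product.Properties as Productₚ
import Data.Rational.Properties as ℚₚ
import Data.Rational.Unnormalised.Base as ℚᵘ
import Data.Rational.Unnormalised.Properties as ℚᵘₚ
open import Data.Sum.Base using (_⊎_; inj₁; inj₂)
open import Data.Vec.Base as Vec using (_∷_; []; lookup)
import Data.Vec.Properties as Vecₚ
open import Function.Base using (_∘_; id; case_of_)
open import Level using (Level)
open import Relation.Binary.Construct.Closure.ReflexiveTransitive using (Star; ε; _◅_)
open import Relation.Binary.Definitions using (DecidableEquality)
open import Relation.Binary.PropositionalEquality
open import Relation.Nullary.Decidable using (Dec; yes; no; ⌊_⌋; does; _⊎-dec_; _×-dec_; ¬?)
open import Relation.Nullary.Negation using (¬_; contradiction)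
open import Relation.Unary using (Pred; Decidable)

private variable
  a p q : Level
  A B : Set a
  n : ℕ

-- Lists

length-middle : ∀ (xs : List A) {x ys} → length (xs ++ x ∷ ys) ≡ suc (length (xs ++ ys))
length-middle [] = refl
length-middle (_ ∷ xs) = cong suc (length-middle xs)

Unique-⊆-length : ∀ {xs ys : List A} → Unique xs → (∀ {x} → x ∈ xs → x ∈ ys) → length xs ℕ.≤ length ys
Unique-⊆-length {xs = []} [] _ = z≤n
Unique-⊆-length {xs = x ∷ xs} (x∉ ∷ u) xs⊆ys with ∈-∃++ (xs⊆ys (here refl))
... | ys₁ , ys₂ , refl = begin
  suc (length xs)            ≤⟨ s≤s (Unique-⊆-length u xs⊆) ⟩
  suc (length (ys₁ ++ ys₂))  ≡⟨ length-middle ys₁ ⟨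
  length (ys₁ ++ x ∷ ys₂)    ∎
  where
  open ℕₚ.≤-Reasoning
  xs⊆ : ∀ {z} → z ∈ xs → z ∈ ys₁ ++ ys₂
  xs⊆ z∈ with ∈-++⁻ ys₁ (xs⊆ys (there z∈))
  ... | inj₁ z∈ys₁ = ∈-++⁺ˡ z∈ys₁
  ... | inj₂ (here refl) = contradiction refl (All.lookup x∉ z∈)
  ... | inj₂ (there z∈ys₂) = ∈-++⁺ʳ ys₁ z∈ys₂

filter-split : ∀ {P : Pred A p} {Q : Pred A q} (P? : Decidable P) (Q? : Decidable Q) → (∀ {x} → Q x → P x) → ∀ xs →
  length (filter P? xs) ≡ length (filter Q? xs) ℕ.+ length (filter (λ x → P? x ×-dec ¬? (Q? x)) xs)
filter-split P? Q? Q⊆P [] = refl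
filter-split P? Q? Q⊆P (x ∷ xs) with P? x | Q? x
... | yes _ | yes _ = cong suc (filter-split P? Q? Q⊆P xs)
... | yes _ | no _ = trans (cong suc (filter-split P? Q? Q⊆P xs)) (sym (ℕₚ.+-suc _ _))
... | no ¬p | yes q = contradiction (Q⊆P q) ¬p
... | no _ | no _ = filter-split P? Q? Q⊆P xs

length-cartesianProduct : ∀ (xs : List A) (ys : List B) → length (cartesianProduct xs ys) ≡ length xs ℕ.* length ys
length-cartesianProduct [] ys = refl
length-cartesianProduct (x ∷ xs) ys = trans (Listₚ.length-++ (map (x ,_) ys)) (cong₂ ℕ._+_ (Listₚ.length-map (x ,_) ys) (length-cartesianProduct xs ys))

Unique-map-injective : ∀ {f : A → B} {xs x y} → Unique (map f xs) → x ∈ xs → y ∈ xs → f x ≡ f y → x ≡ y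
Unique-map-injective u (here refl) (here refl) eq = refl
Unique-map-injective {f = f} (x∉ ∷ u) (here refl) (there y∈) eq = contradiction eq (All.lookup x∉ (∈-map⁺ f y∈))
Unique-map-injective {f = f} (x∉ ∷ u) (there x∈) (here refl) eq = contradiction (sym eq) (All.lookup x∉ (∈-map⁺ f x∈))
Unique-map-injective (_ ∷ u) (there x∈) (there y∈) eq = Unique-map-injective u x∈ y∈ eq

-- Integer sums

module Sums where

  open import Data.Integer.Base using (ℤ; -_; 0ℤ; 1ℤ; -1ℤ; _+_; _-_; _*_; _≤_)
  open ℤ-Solver using (solve-∀)

  ⟦_⟧ : Bool → ℤ
  ⟦ true ⟧ = 1ℤ
  ⟦ false ⟧ = 0ℤ

  ∑ : (A → ℤ) → List A → ℤ
  ∑ f [] = 0ℤ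
  ∑ f (x ∷ xs) = f x + ∑ f xs

  ∑-cong : {f g : A → ℤ} → (∀ x → f x ≡ g x) → ∀ xs → ∑ f xs ≡ ∑ g xs
  ∑-cong h [] = refl
  ∑-cong h (x ∷ xs) = cong₂ _+_ (h x) (∑-cong h xs)

  ∑-mono : {f g : A → ℤ} → (∀ x → f x ≤ g x) → ∀ xs → ∑ f xs ≤ ∑ g xs
  ∑-mono h [] = ℤₚ.≤-refl
  ∑-mono h (x ∷ xs) = ℤₚ.+-mono-≤ (h x) (∑-mono h xs)

  ∑-zero : ∀ (xs : List A) → ∑ (λ _ → 0ℤ) xs ≡ 0ℤ
  ∑-zero [] = refl
  ∑-zero (x ∷ xs) = trans (ℤₚ.+-identityˡ _) (∑-zero xs)

  interchange : ∀ a b c d → (a + b) + (c + d) ≡ (a + c) + (b + d)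
  interchange = solve-∀

  ∑-+ : ∀ (f g : A → ℤ) xs → ∑ (λ x → f x + g x) xs ≡ ∑ f xs + ∑ g xs
  ∑-+ f g [] = refl
  ∑-+ f g (x ∷ xs) = trans (cong (_+_ (f x + g x)) (∑-+ f g xs)) (interchange (f x) (g x) (∑ f xs) (∑ g xs))

  ∑-- : ∀ (f : A → ℤ) xs → ∑ (λ x → - f x) xs ≡ - ∑ f xs
  ∑-- f [] = refl
  ∑-- f (x ∷ xs) = trans (cong (_+_ (- f x)) (∑-- f xs)) (sym (ℤₚ.neg-distrib-+ (f x) (∑ f xs)))

  ∑-∸ : ∀ (f g : A → ℤ) xs → ∑ (λ x → f x - g x) xs ≡ ∑ f xs - ∑ g xs
  ∑-∸ f g xs = trans (∑-+ f (λ x → - g x) xs) (cong (_+_ (∑ f xs)) (∑-- g xs))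

  ∑-*ˡ : ∀ c (f : A → ℤ) xs → ∑ (λ x → c * f x) xs ≡ c * ∑ f xs
  ∑-*ˡ c f [] = sym (ℤₚ.*-zeroʳ c)
  ∑-*ˡ c f (x ∷ xs) = trans (cong (_+_ (c * f x)) (∑-*ˡ c f xs)) (sym (ℤₚ.*-distribˡ-+ c (f x) (∑ f xs)))

  ∑-map : ∀ (f : B → ℤ) (g : A → B) xs → ∑ f (map g xs) ≡ ∑ (f ∘ g) xs
  ∑-map f g [] = refl
  ∑-map f g (x ∷ xs) = cong (_+_ (f (g x))) (∑-map f g xs)

  ∑-swap : ∀ (f : A → B → ℤ) xs ys → ∑ (λ x → ∑ (f x) ys) xs ≡ ∑ (λ y → ∑ (λ x → f x y) xs) ys
  ∑-swap f [] ys = sym (∑-zero ys)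
  ∑-swap f (x ∷ xs) ys = trans (cong (_+_ (∑ (f x) ys)) (∑-swap f xs ys)) (sym (∑-+ (f x) (λ y → ∑ (λ x → f x y) xs) ys))

  module _ {P : Pred A p} (P? : Decidable P) where

    ∑-filter : ∀ (f : A → ℤ) → (∀ x → ¬ P x → f x ≡ 0ℤ) → ∀ xs → ∑ f (filter P? xs) ≡ ∑ f xs
    ∑-filter f h [] = refl
    ∑-filter f h (x ∷ xs) with P? x
    ... | yes _ = cong (_+_ (f x)) (∑-filter f h xs)
    ... | no ¬p = trans (∑-filter f h xs) (sym (trans (cong (_+ ∑ f xs) (h x ¬p)) (ℤₚ.+-identityˡ _)))

    ∑-does : ∀ xs → ∑ (λ x → ⟦ does (P? x) ⟧) xs ≡ + length (filter P? xs)
    ∑-does [] = refl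
    ∑-does (x ∷ xs) with P? x
    ... | yes _ = cong (_+_ 1ℤ) (∑-does xs)
    ... | no ¬p = trans (ℤₚ.+-identityˡ _) (∑-does xs)

  module _ (_≟_ : DecidableEquality A) where

    ∑-delta-∉ : ∀ (f : A → ℤ) {y xs} → y ∉ xs → ∑ (λ x → ⟦ ⌊ y ≟ x ⌋ ⟧ * f x) xs ≡ 0ℤ
    ∑-delta-∉ f {y} {[]} y∉ = refl
    ∑-delta-∉ f {y} {x ∷ xs} y∉ with y ≟ x
    ... | yes y≡x = contradiction (here y≡x) y∉
    ... | no _ = trans (ℤₚ.+-identityˡ _) (∑-delta-∉ f (y∉ ∘ there))

    ∑-delta : ∀ (f : A → ℤ) {y xs} → Unique xs → y ∈ xs → ∑ (λ x → ⟦ ⌊ y ≟ x ⌋ ⟧ * f x) xs ≡ f y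
    ∑-delta f {y} {x ∷ xs} (x∉ ∷ u) y∈ with y ≟ x
    ... | yes refl = trans (cong₂ _+_ (ℤₚ.*-identityˡ (f y)) (∑-delta-∉ f λ y∈xs → All.lookup x∉ y∈xs refl)) (ℤₚ.+-identityʳ _)
    ... | no y≢x with y∈
    ...   | here y≡x = contradiction y≡x y≢x
    ...   | there y∈xs = trans (ℤₚ.+-identityˡ _) (∑-delta f u y∈xs)

  ⟦⌊⌋⟧-cong : ∀ {P : Set p} {Q : Set q} (P? : Dec P) (Q? : Dec Q) → (P → Q) → (Q → P) → ⟦ ⌊ P? ⌋ ⟧ ≡ ⟦ ⌊ Q? ⌋ ⟧
  ⟦⌊⌋⟧-cong (yes _) (yes _) f g = refl
  ⟦⌊⌋⟧-cong (no _) (no _) f g = refl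
  ⟦⌊⌋⟧-cong (yes p) (no ¬q) f g = contradiction (f p) ¬q
  ⟦⌊⌋⟧-cong (no ¬p) (yes q) f g = contradiction (g q) ¬p

  ⟦⌊⌋⟧-no : ∀ {P : Set p} (P? : Dec P) → ¬ P → ⟦ ⌊ P? ⌋ ⟧ ≡ 0ℤ
  ⟦⌊⌋⟧-no (yes p) ¬p = contradiction p ¬p
  ⟦⌊⌋⟧-no (no _) _ = refl

  ⟦∧⟧ : ∀ a b → ⟦ a ∧ b ⟧ ≡ ⟦ a ⟧ * ⟦ b ⟧
  ⟦∧⟧ true true = refl
  ⟦∧⟧ true false = refl
  ⟦∧⟧ false b = refl

  ∑-congᴬ : {f g : A → ℤ} → ∀ {xs} → All (λ x → f x ≡ g x) xs → ∑ f xs ≡ ∑ g xs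
  ∑-congᴬ [] = refl
  ∑-congᴬ (h ∷ hs) = cong₂ _+_ h (∑-congᴬ hs)

  ∣∣-∑ : ∀ (S : Subset n) → + ∣ S ∣ ≡ ∑ (λ e → ⟦ lookup S e ⟧) (allFin n)
  ∣∣-∑ [] = refl
  ∣∣-∑ {suc n} (b ∷ S) = trans (first b) (cong (_+_ ⟦ b ⟧) rest)
    where
    first : ∀ b → + ∣ b ∷ S ∣ ≡ ⟦ b ⟧ + + ∣ S ∣
    first true = refl
    first false = refl
    f : Fin (suc n) → ℤ
    f e = ⟦ lookup (b ∷ S) e ⟧
    rest : + ∣ S ∣ ≡ ∑ (λ e → ⟦ lookup (b ∷ S) e ⟧) (tabulate suc)
    rest = trans (∣∣-∑ S) (trans (sym (∑-map f suc (allFin n))) (cong (∑ f) (Listₚ.map-tabulate id suc)))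

  -- The change of `⟦ b ⟧` when `b` is flipped: the effect that augmenting along an edge has on its
  -- membership.
  sign : Bool → ℤ
  sign true = -1ℤ
  sign false = 1ℤ

  ⟦xor⟧ : ∀ a b → ⟦ a xor b ⟧ ≡ ⟦ a ⟧ + ⟦ b ⟧ * sign a
  ⟦xor⟧ true true = refl
  ⟦xor⟧ true false = refl
  ⟦xor⟧ false true = refl
  ⟦xor⟧ false false = refl

  lookup-⊕ : ∀ (S T : Subset n) i → lookup ((S ─ T) ∪ (T ─ S)) i ≡ lookup S i xor lookup T i
  lookup-⊕ (true ∷ S) (true ∷ T) zero = refl
  lookup-⊕ (true ∷ S) (false ∷ T) zero = refl
  lookup-⊕ (false ∷ S) (true ∷ T) zero = refl
  lookup-⊕ (false ∷ S) (false ∷ T) zero = refl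
  lookup-⊕ (_ ∷ S) (_ ∷ T) (suc i) = lookup-⊕ S T i

  lookup-⁅⁆ : ∀ (i j : Fin n) → lookup ⁅ i ⁆ j ≡ ⌊ i Finₚ.≟ j ⌋
  lookup-⁅⁆ zero zero = refl
  lookup-⁅⁆ zero (suc j) = Vecₚ.lookup-replicate j false
  lookup-⁅⁆ (suc i) zero = refl
  lookup-⁅⁆ (suc i) (suc j) with i Finₚ.≟ j | lookup-⁅⁆ i j
  ... | yes _ | eq = eq
  ... | no _ | eq = eq

  lookup-⋃ : ∀ {is : List (Fin n)} {j} → lookup (⋃ (map ⁅_⁆ is)) j ≡ true → j ∈ is
  lookup-⋃ {is = []} {j} eq = contradiction (trans (sym (Vecₚ.lookup-replicate j false)) eq) λ ()
  lookup-⋃ {is = i ∷ is} {j} eq with i Finₚ.≟ j | lookup-⁅⁆ i j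
  ... | yes i≡j | _ = here (sym i≡j)
  ... | no _ | eq′ = there (lookup-⋃ (trans (cong (_∨ lookup (⋃ (map ⁅_⁆ is)) j) (sym eq′)) (trans (sym (Vecₚ.lookup-zipWith _∨_ j ⁅ i ⁆ (⋃ (map ⁅_⁆ is)))) eq)))

  -- By uniqueness the singletons are disjoint, so their indicators add up. This carries degree
  -- counts from the edge set of a trail to its list of edges.
  ∑-⋃ : ∀ (g : Fin n → ℤ) {is} → Unique is → ∑ (λ j → ⟦ lookup (⋃ (map ⁅_⁆ is)) j ⟧ * g j) (allFin n) ≡ ∑ g is
  ∑-⋃ {n} g [] = trans (∑-cong (λ j → cong (λ b → ⟦ b ⟧ * g j) (Vecₚ.lookup-replicate j false)) (allFin n)) (∑-zero (allFin n))
  ∑-⋃ {n} g {i ∷ is} (i∉ ∷ u) = begin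
    ∑ (λ j → ⟦ lookup (⁅ i ⁆ ∪ S) j ⟧ * g j) (allFin n)                      ≡⟨ ∑-cong split (allFin n) ⟩
    ∑ (λ j → ⟦ ⌊ i Finₚ.≟ j ⌋ ⟧ * g j + ⟦ lookup S j ⟧ * g j) (allFin n)     ≡⟨ ∑-+ _ _ (allFin n) ⟩
    ∑ (λ j → ⟦ ⌊ i Finₚ.≟ j ⌋ ⟧ * g j) (allFin n) + ∑ (λ j → ⟦ lookup S j ⟧ * g j) (allFin n)
      ≡⟨ cong₂ _+_ (∑-delta Finₚ._≟_ g (Uniqueₚ.allFin⁺ n) (∈-allFin i)) (∑-⋃ g u) ⟩
    g i + ∑ g is ∎
    where
    open ≡-Reasoning
    S = ⋃ (map ⁅_⁆ is)
    i∉S : lookup S i ≢ true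
    i∉S eq = All.lookup i∉ (lookup-⋃ eq) refl
    disjoint : ∀ j → ⟦ ⌊ i Finₚ.≟ j ⌋ ∨ lookup S j ⟧ ≡ ⟦ ⌊ i Finₚ.≟ j ⌋ ⟧ + ⟦ lookup S j ⟧
    disjoint j with i Finₚ.≟ j
    ... | yes refl = sym (cong (λ b → 1ℤ + ⟦ b ⟧) (Boolₚ.¬-not i∉S))
    ... | no _ = sym (ℤₚ.+-identityˡ _)
    split : ∀ j → ⟦ lookup (⁅ i ⁆ ∪ S) j ⟧ * g j ≡ ⟦ ⌊ i Finₚ.≟ j ⌋ ⟧ * g j + ⟦ lookup S j ⟧ * g j
    split j = trans (cong (λ b → ⟦ b ⟧ * g j) (trans (Vecₚ.lookup-zipWith _∨_ j ⁅ i ⁆ S) (cong (_∨ lookup S j) (lookup-⁅⁆ i j))))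
      (trans (cong (_* g j) (disjoint j)) (ℤₚ.*-distribʳ-+ (g j) ⟦ ⌊ i Finₚ.≟ j ⌋ ⟧ ⟦ lookup S j ⟧))

-- Balanced orientations

module Orientation {V : Set} (_≟_ : DecidableEquality V) where

  open Sums
  open import Data.Integer.Base using (ℤ; 0ℤ; 1ℤ; -1ℤ; _+_; _-_)
  open ℤ-Solver using (solve-∀)

  -- Absolute value at most one, as an inductive type so that the direction of an edge can be chosen
  -- by cases.
  data Within1 : ℤ → Set where
    neg  : Within1 -1ℤ
    zero : Within1 0ℤ
    pos  : Within1 1ℤ

  δ : V → V → ℤ
  δ u v = ⟦ ⌊ u ≟ v ⌋ ⟧

  net : V → V × V → ℤ
  net v (u , w) = δ u v - δ w v

  Orients : V × V → V × V → Set
  Orients (u , w) e = e ≡ (u , w) ⊎ e ≡ (w , u)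

  Balanced : List (V × V) → Set
  Balanced as = ∀ v → Within1 (∑ (net v) as)

  δ-≢ : ∀ {u v} → u ≢ v → δ u v ≡ 0ℤ
  δ-≢ {u} {v} u≢v with u ≟ v
  ... | yes u≡v = contradiction u≡v u≢v
  ... | no _ = refl

  Avoids : V → V × V → Set
  Avoids w (x , y) = x ≢ w × y ≢ w

  search : ∀ w es → (∃₂ λ es₁ x → ∃ λ es₂ → es ≡ es₁ ++ (w , x) ∷ es₂ ⊎ es ≡ es₁ ++ (x , w) ∷ es₂) ⊎ All (Avoids w) es
  search w [] = inj₂ []
  search w ((x , y) ∷ es) with x ≟ w | y ≟ w
  ... | yes refl | _ = inj₁ ([] , y , es , inj₁ refl)
  ... | no _ | yes refl = inj₁ ([] , x , es , inj₂ refl)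
  ... | no x≢w | no y≢w with search w es
  ...   | inj₁ (es₁ , z , es₂ , inj₁ eq) = inj₁ ((x , y) ∷ es₁ , z , es₂ , inj₁ (cong ((x , y) ∷_) eq))
  ...   | inj₁ (es₁ , z , es₂ , inj₂ eq) = inj₁ ((x , y) ∷ es₁ , z , es₂ , inj₂ (cong ((x , y) ∷_) eq))
  ...   | inj₂ av = inj₂ ((x≢w , y≢w) ∷ av)

  -- The new arc has to sit at the position of its edge. A formula valid for every sum `∑ f`
  -- replaces reasoning about permutations.
  insert : ∀ es₁ {es₂ as e b} → Pointwise Orients (es₁ ++ es₂) as → Orients e b →
           ∃ λ as′ → Pointwise Orients (es₁ ++ e ∷ es₂) as′ × (∀ f → ∑ f as′ ≡ f b + ∑ f as)
  insert [] {b = b} os o = b ∷ _ , o ∷ os , λ f → refl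
  insert (_ ∷ es₁) {as = a ∷ as} {b = b} (o′ ∷ os) o with insert es₁ os o
  ... | as′ , os′ , eq = a ∷ as′ , o′ ∷ os′ , λ f → trans (cong (_+_ (f a)) (eq f)) (swap (f a) (f b) (∑ f as))
    where
    swap : ∀ x y z → x + (y + z) ≡ y + (x + z)
    swap = solve-∀

  avoid-net : ∀ {w es as} → Pointwise Orients es as → All (Avoids w) es → ∑ (net w) as ≡ 0ℤ
  avoid-net [] [] = refl
  avoid-net (inj₁ refl ∷ os) ((x≢ , y≢) ∷ av) = cong₂ _+_ (cong₂ _-_ (δ-≢ x≢) (δ-≢ y≢)) (avoid-net os av)
  avoid-net (inj₂ refl ∷ os) ((x≢ , y≢) ∷ av) = cong₂ _+_ (cong₂ _-_ (δ-≢ y≢) (δ-≢ x≢)) (avoid-net os av)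

  Orientable : List (V × V) → Set
  Orientable es = ∃ λ as → Pointwise Orients es as × Balanced as

  -- Two edges meeting in w are replaced by a single one that bypasses w.
  join : ∀ {u w x es₁ es₂ e} → Orients e (w , x) → Orients e (x , w) →
         Orientable ((u , x) ∷ es₁ ++ es₂) → Orientable ((u , w) ∷ es₁ ++ e ∷ es₂)
  join {u} {w} {x} {es₁} o o′ (_ ∷ as , inj₁ refl ∷ os , bal) with insert es₁ os o
  ... | as′ , os′ , eq = (u , w) ∷ as′ , inj₁ refl ∷ os′ , λ v →
    subst Within1 (trans (through (δ u v) (δ x v) (δ w v) (∑ (net v) as)) (cong (_+_ (net v (u , w))) (sym (eq (net v))))) (bal v)
    where
    through : ∀ u x w s → (u - x) + s ≡ (u - w) + ((w - x) + s)
    through = solve-∀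
  join {u} {w} {x} {es₁} o o′ (_ ∷ as , inj₂ refl ∷ os , bal) with insert es₁ os o′
  ... | as′ , os′ , eq = (w , u) ∷ as′ , inj₂ refl ∷ os′ , λ v →
    subst Within1 (trans (through (δ u v) (δ x v) (δ w v) (∑ (net v) as)) (cong (_+_ (net v (w , u))) (sym (eq (net v))))) (bal v)
    where
    through : ∀ u x w s → (x - u) + s ≡ (w - u) + ((x - w) + s)
    through = solve-∀

  -- No edge of `es` meets `w`, so either direction leaves `w` with net degree plus or minus one.
  -- The direction is dictated by `u` alone, whose net degree moves to zero unless it was zero
  -- before.
  attach : ∀ {u w es} → u ≢ w → All (Avoids w) es → Orientable es → Orientable ((u , w) ∷ es)
  attach {u} {w} u≢w av (as , os , bal) = choose (bal u) refl
    where
    outward : Within1 (1ℤ + ∑ (net u) as) → Orientable _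
    outward unit = (u , w) ∷ as , inj₁ refl ∷ os , bal′
      where
      bal′ : Balanced ((u , w) ∷ as)
      bal′ v with u ≟ v | w ≟ v
      ... | yes refl | yes refl = contradiction refl u≢w
      ... | yes refl | no _ = unit
      ... | no _ | yes refl = subst (λ i → Within1 (-1ℤ + i)) (sym (avoid-net os av)) neg
      ... | no _ | no _ = subst Within1 (sym (ℤₚ.+-identityˡ _)) (bal v)

    inward : Within1 (-1ℤ + ∑ (net u) as) → Orientable _
    inward unit = (w , u) ∷ as , inj₂ refl ∷ os , bal′
      where
      bal′ : Balanced ((w , u) ∷ as)
      bal′ v with w ≟ v | u ≟ v
      ... | yes refl | yes refl = contradiction refl u≢w
      ... | yes refl | no _ = subst (λ i → Within1 (1ℤ + i)) (sym (avoid-net os av)) pos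
      ... | no _ | yes refl = unit
      ... | no _ | no _ = subst Within1 (sym (ℤₚ.+-identityˡ _)) (bal v)

    choose : ∀ {i} → Within1 i → ∑ (net u) as ≡ i → Orientable _
    choose neg eq = outward (subst (λ i → Within1 (1ℤ + i)) (sym eq) zero)
    choose zero eq = outward (subst (λ i → Within1 (1ℤ + i)) (sym eq) pos)
    choose pos eq = inward (subst (λ i → Within1 (-1ℤ + i)) (sym eq) zero)

  -- The induction is on a bound for the number of edges, because joining two edges at `w` yields a
  -- list that is not a tail of the given one. A loop contributes zero to `net`; any other edge is
  -- joined to a second edge at `w`, or attached if there is none.
  orient′ : ∀ n es → length es ℕ.≤ n → Orientable es
  orient′ _ [] _ = [] , [] , λ v → zero
  orient′ (suc n) ((u , w) ∷ es) (s≤s len) with u ≟ w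
  ... | yes refl with orient′ n es len
  ...   | as , os , bal = (u , u) ∷ as , inj₁ refl ∷ os , λ v → subst Within1 (sym (loop v)) (bal v)
    where
    loop : ∀ v → net v (u , u) + ∑ (net v) as ≡ ∑ (net v) as
    loop v = trans (cong (_+ ∑ (net v) as) (ℤₚ.+-inverseʳ (δ u v))) (ℤₚ.+-identityˡ _)
  orient′ (suc n) ((u , w) ∷ es) (s≤s len) | no u≢w with search w es
  ... | inj₂ av = attach u≢w av (orient′ n es len)
  ... | inj₁ (es₁ , x , es₂ , inj₁ refl) = join {es₁ = es₁} (inj₁ refl) (inj₂ refl) (orient′ n _ (subst (ℕ._≤ n) (length-middle es₁) len))
  ... | inj₁ (es₁ , x , es₂ , inj₂ refl) = join {es₁ = es₁} (inj₂ refl) (inj₁ refl) (orient′ n _ (subst (ℕ._≤ n) (length-middle es₁) len))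

  orient : ∀ es → Orientable es
  orient es = orient′ (length es) es ℕₚ.≤-refl

-- The flow of an orientation

module Flow (G : Graph) (simple : Graph.Simple G) (f : Graph.Vertex G → ℕ) (M N : Graph.Edges G)
            (isM : Graph.Matching.IsMatching G f M) (isN : Graph.Matching.IsMatching G f N) where

  open Graph G
  open Matching f
  open Sums
  open import Data.Integer.Base using (ℤ; -_; 0ℤ; 1ℤ; -1ℤ; _+_; _-_; _*_; _≤_; _<_; +≤+; -≤+)
  open ℤ-Solver using (solve-∀)

  open Orientation (Finₚ._≟_ {∣V∣})

  incidence : Edge → Vertex → ℤ
  incidence e v = δ (end₁ e) v + δ (end₂ e) v

  degree-∑ : ∀ S v → + degree S v ≡ ∑ (λ e → ⟦ lookup S e ⟧ * incidence e v) (allFin ∣E∣)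
  degree-∑ S v = begin
    + degree S v ≡⟨ cong₂ _+_ (count end₁) (count end₂) ⟩
    _            ≡⟨ ∑-+ _ _ (allFin ∣E∣) ⟨
    _            ≡⟨ ∑-cong (λ e → ℤₚ.*-distribˡ-+ ⟦ lookup S e ⟧ (δ (end₁ e) v) (δ (end₂ e) v)) (allFin ∣E∣) ⟨
    _            ∎
    where
    open ≡-Reasoning
    count : ∀ (end : Edge → Vertex) → + ∣ S ∩ Vec.tabulate (λ e → ⌊ end e Finₚ.≟ v ⌋) ∣ ≡ ∑ (λ e → ⟦ lookup S e ⟧ * δ (end e) v) (allFin ∣E∣)
    count end = trans (∣∣-∑ (S ∩ Vec.tabulate _)) (∑-cong pointwise (allFin ∣E∣))
      where
      pointwise : ∀ e → ⟦ lookup (S ∩ Vec.tabulate (λ e → ⌊ end e Finₚ.≟ v ⌋)) e ⟧ ≡ ⟦ lookup S e ⟧ * δ (end e) v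
      pointwise e = trans (cong ⟦_⟧ (trans (Vecₚ.lookup-zipWith _∧_ e S _) (cong (lookup S e ∧_) (Vecₚ.lookup∘tabulate _ e))))
        (⟦∧⟧ (lookup S e) _)

  -- Flipping an edge changes its indicator by `sign` of the old value, and `incidence` counts a
  -- loop twice, as `degree` does.
  degree-⊕ : ∀ {es} v → Unique es → + degree (M ⊕ ⋃ (map ⁅_⁆ es)) v ≡ + degree M v + ∑ (λ e → sign (lookup M e) * incidence e v) es
  degree-⊕ {es} v u = begin
    + degree (M ⊕ S) v ≡⟨ degree-∑ (M ⊕ S) v ⟩
    _                  ≡⟨ ∑-cong split (allFin ∣E∣) ⟩
    _                  ≡⟨ ∑-+ _ _ (allFin ∣E∣) ⟩
    _                  ≡⟨ cong₂ _+_ (sym (degree-∑ M v)) (∑-⋃ _ u) ⟩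
    _                  ∎
    where
    open ≡-Reasoning
    S = ⋃ (map ⁅_⁆ es)
    expand : ∀ m s g i → (m + s * g) * i ≡ m * i + s * (g * i)
    expand = solve-∀
    split : ∀ e → ⟦ lookup (M ⊕ S) e ⟧ * incidence e v ≡ ⟦ lookup M e ⟧ * incidence e v + ⟦ lookup S e ⟧ * (sign (lookup M e) * incidence e v)
    split e = trans (cong (_* incidence e v) (trans (cong ⟦_⟧ (lookup-⊕ M S e)) (⟦xor⟧ (lookup M e) (lookup S e))))
      (expand ⟦ lookup M e ⟧ ⟦ lookup S e ⟧ (sign (lookup M e)) (incidence e v))

  -- Orienting the symmetric difference of `M` and `N`

  record Arc : Set where
    constructor arc
    field
      edge      : Edge
      tail head : Vertex
      joins     : Joins edge tail head

  open Arc

  ends : Edge → Vertex × Vertex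
  ends e = end₁ e , end₂ e

  matched : Arc → Bool
  matched a = lookup M (edge a)

  differ? : Decidable (λ e → lookup M e xor lookup N e ≡ true)
  differ? e = (lookup M e xor lookup N e) Boolₚ.≟ true

  difference : List Edge
  difference = filter differ? (allFin ∣E∣)

  -- A pair of vertices does not carry its edge. Restoring it gives access to whether an arc is
  -- matched and to its place in a walk.
  toArcs : ∀ {es as} → Pointwise Orients (map ends es) as →
           ∃ λ arcs → map edge arcs ≡ es × map (λ a → tail a , head a) arcs ≡ as
  toArcs {[]} [] = [] , refl , refl
  toArcs {e ∷ es} (inj₁ refl ∷ os) with toArcs os
  ... | arcs , eq₁ , eq₂ = arc e _ _ (inj₁ (refl , refl)) ∷ arcs , cong (_ ∷_) eq₁ , cong (_ ∷_) eq₂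
  toArcs {e ∷ es} (inj₂ refl ∷ os) with toArcs os
  ... | arcs , eq₁ , eq₂ = arc e _ _ (inj₂ (refl , refl)) ∷ arcs , cong (_ ∷_) eq₁ , cong (_ ∷_) eq₂

  record Oriented : Set where
    field
      arcs     : List Arc
      covers   : map edge arcs ≡ difference
      balanced : ∀ v → Within1 (∑ (λ a → δ (tail a) v - δ (head a) v) arcs)

  oriented : Oriented
  oriented with orient (map ends difference)
  ... | as , os , bal with toArcs os
  ...   | arcs , eq , refl = record
    { arcs = arcs
    ; covers = eq
    ; balanced = λ v → subst Within1 (∑-map (net v) _ arcs) (bal v)
    }

  -- Here `m` tells whether an arc is matched, `s` and `t` whether its source and target lie in a
  -- set of states. The terms in `m` add up to `sign m`; the rest is the indicator of leaving the
  -- set, hence nonnegative.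
  crossing : ∀ m s t → sign m * 1ℤ ≤ ⟦ t ∧ not s ⟧ + ((⟦ s ⟧ - ⟦ m ⟧) - (⟦ t ⟧ - ⟦ not m ⟧))
  crossing true true true = ℤₚ.≤-refl
  crossing true true false = -≤+
  crossing true false true = ℤₚ.≤-refl
  crossing true false false = ℤₚ.≤-refl
  crossing false true true = ℤₚ.≤-refl
  crossing false true false = +≤+ (s≤s z≤n)
  crossing false false true = ℤₚ.≤-refl
  crossing false false false = ℤₚ.≤-refl

  within1-lower : ∀ {i} → Within1 i → -1ℤ ≤ i
  within1-lower neg = ℤₚ.≤-refl
  within1-lower zero = -≤+
  within1-lower pos = -≤+

  within1-upper : ∀ {i} → Within1 i → i ≤ 1ℤ
  within1-upper neg = -≤+
  within1-upper zero = +≤+ z≤n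
  within1-upper pos = ℤₚ.≤-refl

  -- The gap is `2a - (a + t)`, at least 2 - 1. For the excesses `a` and `t` of the two states of a
  -- vertex it is the surplus of its degree in `N` over that in `M`.
  positive-gap : ∀ a t → 0ℤ < a → Within1 (a + t) → 1ℤ ≤ a - t
  positive-gap a t 0<a unit = subst (1ℤ ≤_) (lem a t) (ℤₚ.+-mono-≤ (ℤₚ.+-mono-≤ 1≤a 1≤a) (ℤₚ.neg-mono-≤ (within1-upper unit)))
    where
    1≤a = ℤₚ.i<j⇒suc[i]≤j 0<a
    lem : ∀ a t → (a + a) - (a + t) ≡ a - t
    lem = solve-∀

  -- Now the gap is written as `(a + t) - 2t`, at least -1 + 2.
  negative-gap : ∀ a t → t < 0ℤ → Within1 (a + t) → 1ℤ ≤ a - t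
  negative-gap a t t<0 unit = subst (1ℤ ≤_) (lem a t) (ℤₚ.+-mono-≤ (within1-lower unit) (ℤₚ.+-mono-≤ -t≥1 -t≥1))
    where
    -t≥1 = ℤₚ.neg-mono-≤ (ℤₚ.i<j⇒i≤pred[j] t<0)
    lem : ∀ a t → (a + t) + (- t - t) ≡ a - t
    lem = solve-∀

  -- States, arcs between them, and excesses

  module Directed (O : Oriented) where

    open Oriented O

    -- The Boolean tells whether the next edge of a path has to be matched.
    State : Set
    State = Vertex × Bool

    _≟ˢ_ : DecidableEquality State
    _≟ˢ_ = Productₚ.≡-dec Finₚ._≟_ Boolₚ._≟_

    source target : Arc → State
    source a = tail a , matched a
    target a = head a , not (matched a)

    Δ : State → State → ℤ
    Δ x y = ⟦ ⌊ x ≟ˢ y ⌋ ⟧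

    excess : State → ℤ
    excess x = ∑ (λ a → Δ (source a) x - Δ (target a) x) arcs

    Δ-same : ∀ u v b → Δ (u , b) (v , b) ≡ δ u v
    Δ-same u v b = ⟦⌊⌋⟧-cong (_ ≟ˢ _) (u Finₚ.≟ v) (cong proj₁) (cong (_, b))

    Δ-other : ∀ u v {b c} → b ≢ c → Δ (u , b) (v , c) ≡ 0ℤ
    Δ-other u v b≢c = ⟦⌊⌋⟧-no (_ ≟ˢ _) (b≢c ∘ cong proj₂)

    -- Summing over the two states forgets the matching and leaves the net degree of the
    -- orientation.
    excess-sum : ∀ v → Within1 (excess (v , false) + excess (v , true))
    excess-sum v = subst Within1 (trans (∑-cong pointwise arcs) (∑-+ _ _ arcs)) (balanced v)
      where
      pointwise : ∀ a → δ (tail a) v - δ (head a) v ≡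
        (Δ (source a) (v , false) - Δ (target a) (v , false)) + (Δ (source a) (v , true) - Δ (target a) (v , true))
      pointwise a with matched a
      ... | false rewrite Δ-same (tail a) v false | Δ-other (head a) v {true} {false} (λ ()) | Δ-other (tail a) v {false} {true} (λ ()) | Δ-same (head a) v true
        = lem (δ (tail a) v) (δ (head a) v)
        where
        lem : ∀ t h → t - h ≡ (t - 0ℤ) + (0ℤ - h)
        lem = solve-∀
      ... | true rewrite Δ-same (tail a) v true | Δ-other (head a) v {false} {true} (λ ()) | Δ-other (tail a) v {true} {false} (λ ()) | Δ-same (head a) v false
        = lem (δ (tail a) v) (δ (head a) v)
        where
        lem : ∀ t h → t - h ≡ (0ℤ - h) + (t - 0ℤ)
        lem = solve-∀

    incidence-arc : ∀ a v → incidence (edge a) v ≡ δ (tail a) v + δ (head a) v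
    incidence-arc (arc e _ _ (inj₁ (refl , refl))) v = refl
    incidence-arc (arc e _ _ (inj₂ (refl , refl))) v = ℤₚ.+-comm (δ (end₁ e) v) (δ (end₂ e) v)

    -- Edges on which `M` and `N` agree cancel on the right; on the others the difference of the
    -- indicators is `sign` of membership in `M`, whatever the direction of the arc.
    ∑-difference : ∀ (g : Edge → ℤ) → ∑ (λ a → sign (matched a) * g (edge a)) arcs ≡
      ∑ (λ e → ⟦ lookup N e ⟧ * g e) (allFin ∣E∣) - ∑ (λ e → ⟦ lookup M e ⟧ * g e) (allFin ∣E∣)
    ∑-difference g = begin
      ∑ (λ a → sign (matched a) * g (edge a)) arcs       ≡⟨ ∑-map (λ e → sign (lookup M e) * g e) edge arcs ⟨
      ∑ (λ e → sign (lookup M e) * g e) (map edge arcs)  ≡⟨ cong (∑ _) covers ⟩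
      ∑ (λ e → sign (lookup M e) * g e) difference       ≡⟨ ∑-congᴬ (All.map (λ {e} → inside (lookup M e) (lookup N e) (g e)) (Allₚ.all-filter differ? (allFin ∣E∣))) ⟩
      ∑ change difference                                ≡⟨ ∑-filter differ? change (λ e → outside (lookup M e) (lookup N e) (g e)) (allFin ∣E∣) ⟩
      ∑ change (allFin ∣E∣)                              ≡⟨ ∑-∸ _ _ (allFin ∣E∣) ⟩
      _                                                  ∎
      where
      open ≡-Reasoning
      change : Edge → ℤ
      change e = ⟦ lookup N e ⟧ * g e - ⟦ lookup M e ⟧ * g e
      inside : ∀ m n g → m xor n ≡ true → sign m * g ≡ ⟦ n ⟧ * g - ⟦ m ⟧ * g
      inside true false g _ = lem g where
        lem : ∀ g → -1ℤ * g ≡ 0ℤ * g - 1ℤ * g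
        lem = solve-∀
      inside false true g _ = lem g where
        lem : ∀ g → 1ℤ * g ≡ 1ℤ * g - 0ℤ * g
        lem = solve-∀
      outside : ∀ m n g → ¬ (m xor n ≡ true) → ⟦ n ⟧ * g - ⟦ m ⟧ * g ≡ 0ℤ
      outside true true g _ = ℤₚ.+-inverseʳ (1ℤ * g)
      outside false false g _ = ℤₚ.+-inverseʳ (0ℤ * g)
      outside true false g h = contradiction refl h
      outside false true g h = contradiction refl h

    -- The end states of an arc have opposite Booleans: an unmatched arc leaves an unmatched-next
    -- state and enters a matched-next one. Subtraction therefore gives both ends the same sign,
    -- positive for unmatched arcs and negative for matched ones.
    excess-difference : ∀ v → excess (v , false) - excess (v , true) ≡ + degree N v - + degree M v
    excess-difference v = begin
      _ ≡⟨ ∑-∸ _ _ arcs ⟨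
      _ ≡⟨ ∑-cong pointwise arcs ⟩
      _ ≡⟨ ∑-difference (λ e → incidence e v) ⟩
      _ ≡⟨ cong₂ _-_ (degree-∑ N v) (degree-∑ M v) ⟨
      _ ∎
      where
      open ≡-Reasoning
      pointwise : ∀ a → (Δ (source a) (v , false) - Δ (target a) (v , false)) - (Δ (source a) (v , true) - Δ (target a) (v , true))
        ≡ sign (matched a) * incidence (edge a) v
      pointwise a rewrite incidence-arc a v with matched a
      ... | false rewrite Δ-same (tail a) v false | Δ-other (head a) v {true} {false} (λ ()) | Δ-other (tail a) v {false} {true} (λ ()) | Δ-same (head a) v true
        = lem (δ (tail a) v) (δ (head a) v)
        where
        lem : ∀ t h → (t - 0ℤ) - (0ℤ - h) ≡ 1ℤ * (t + h)
        lem = solve-∀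
      ... | true rewrite Δ-same (tail a) v true | Δ-other (head a) v {false} {true} (λ ()) | Δ-other (tail a) v {true} {false} (λ ()) | Δ-same (head a) v false
        = lem (δ (tail a) v) (δ (head a) v)
        where
        lem : ∀ t h → (0ℤ - h) - (t - 0ℤ) ≡ -1ℤ * (t + h)
        lem = solve-∀

    states : List State
    states = cartesianProduct (allFin ∣V∣) (false ∷ true ∷ [])

    states-unique : Unique states
    states-unique = Uniqueₚ.cartesianProduct⁺ (Uniqueₚ.allFin⁺ ∣V∣) (((λ ()) ∷ []) ∷ [] ∷ [])

    ∈-states : ∀ x → x ∈ states
    ∈-states (v , false) = ∈-cartesianProduct⁺ (∈-allFin v) (here refl)
    ∈-states (v , true) = ∈-cartesianProduct⁺ (∈-allFin v) (there (here refl))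

    length-states : length states ≡ ∣V∣ ℕ.* 2
    length-states = trans (length-cartesianProduct (allFin ∣V∣) (false ∷ true ∷ [])) (cong (ℕ._* 2) (Listₚ.length-tabulate {n = ∣V∣} id))

    -- Summation by parts: the differences of a potential along the arcs are collected state by
    -- state.
    ∑-potential : ∀ (χ : State → ℤ) → ∑ (λ a → χ (source a) - χ (target a)) arcs ≡ ∑ (λ x → χ x * excess x) states
    ∑-potential χ = sym (begin
      _ ≡⟨ ∑-cong (λ x → ∑-*ˡ (χ x) _ arcs) states ⟨
      _ ≡⟨ ∑-swap (λ x a → χ x * (Δ (source a) x - Δ (target a) x)) states arcs ⟩
      _ ≡⟨ ∑-cong (λ a → trans (∑-cong (λ x → expand (χ x) (Δ (source a) x) (Δ (target a) x)) states)
             (trans (∑-∸ _ _ states) (cong₂ _-_ (∑-delta _≟ˢ_ χ states-unique (∈-states _)) (∑-delta _≟ˢ_ χ states-unique (∈-states _))))) arcs ⟩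
      _ ∎)
      where
      open ≡-Reasoning
      expand : ∀ c s t → c * (s - t) ≡ s * c - t * c
      expand = solve-∀

    -- Cuts in the graph of states

    module _ {P : Pred State Level.zero} (P? : Decidable P) where

      Enters : Pred Arc Level.zero
      Enters a = P (target a) × ¬ P (source a)

      enters? : Decidable Enters
      enters? a = P? (target a) ×-dec ¬? (P? (source a))

      -- Flow duality with `P` as the sink side. It contains every matched-next state of negative
      -- excess and no unmatched-next state of positive excess, so the surplus of `N` over `M` has
      -- to enter it along arcs.
      cut : (∀ v → P (v , false) → excess (v , false) ≤ 0ℤ) → (∀ v → ¬ P (v , true) → 0ℤ ≤ excess (v , true)) →
            + ∣ N ∣ - + ∣ M ∣ ≤ + length (filter enters? arcs)
      cut starts sinks = begin
        + ∣ N ∣ - + ∣ M ∣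
          ≡⟨ cong₂ _-_ (size N) (size M) ⟩
        _ ≡⟨ ∑-difference (λ _ → 1ℤ) ⟨
        _ ≤⟨ ∑-mono pointwise arcs ⟩
        _ ≡⟨ ∑-+ _ _ arcs ⟩
        _ ≡⟨ cong₂ _+_ (∑-does enters? arcs) (∑-potential χ) ⟩
        _ ≤⟨ ℤₚ.+-monoʳ-≤ (+ length (filter enters? arcs)) (ℤₚ.≤-trans (∑-mono nonpositive states) (ℤₚ.≤-reflexive (∑-zero states))) ⟩
        _ ≡⟨ ℤₚ.+-identityʳ _ ⟩
        + length (filter enters? arcs) ∎
        where
        open ℤₚ.≤-Reasoning
        size : ∀ S → + ∣ S ∣ ≡ ∑ (λ e → ⟦ lookup S e ⟧ * 1ℤ) (allFin ∣E∣)
        size S = trans (∣∣-∑ S) (∑-cong (λ e → sym (ℤₚ.*-identityʳ _)) (allFin ∣E∣))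
        -- Membership in `P`, lowered by one on matched-next states. The lowering produces the term
        -- `sign` of each arc, and the values, 0 or 1 on unmatched-next and -1 or 0 on matched-next
        -- states, have nonpositive products with the excesses.
        χ : State → ℤ
        χ (v , b) = ⟦ does (P? (v , b)) ⟧ - ⟦ b ⟧
        pointwise : ∀ a → sign (matched a) * 1ℤ ≤ ⟦ does (enters? a) ⟧ + (χ (source a) - χ (target a))
        pointwise a = crossing (matched a) (does (P? (source a))) (does (P? (target a)))
        nonpositive : ∀ x → χ x * excess x ≤ 0ℤ
        nonpositive (v , false) with P? (v , false)
        ... | yes p = subst (_≤ 0ℤ) (sym (ℤₚ.*-identityˡ _)) (starts v p)
        ... | no _ = ℤₚ.≤-refl
        nonpositive (v , true) with P? (v , true)
        ... | yes p = ℤₚ.≤-refl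
        ... | no ¬p = subst (_≤ 0ℤ) (sym (ℤₚ.-1*i≡-i _)) (ℤₚ.neg-mono-≤ (sinks v ¬p))

    -- Reachability is backwards from the finishing states, since walks grow at the front.
    Reaches : ℕ → Pred State Level.zero
    Reaches zero x = proj₂ x ≡ true × excess x < 0ℤ
    Reaches (suc j) x = Reaches j x ⊎ Any (λ a → source a ≡ x × Reaches j (target a)) arcs

    reaches? : ∀ j → Decidable (Reaches j)
    reaches? zero x = (proj₂ x Boolₚ.≟ true) ×-dec (excess x ℤₚ.<? 0ℤ)
    reaches? (suc j) x = reaches? j x ⊎-dec any? (λ a → (source a ≟ˢ x) ×-dec reaches? j (target a)) arcs

    Layer : ℕ → Pred State Level.zero
    Layer zero = Reaches zero
    Layer (suc j) x = Reaches (suc j) x × ¬ Reaches j x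

    layer? : ∀ j → Decidable (Layer j)
    layer? zero = reaches? zero
    layer? (suc j) x = reaches? (suc j) x ×-dec ¬? (reaches? j x)

    layer : ℕ → List State
    layer j = filter (layer? j) states

    reached : ℕ → ℕ
    reached j = length (filter (reaches? j) states)

    reached-suc : ∀ j → reached (suc j) ≡ reached j ℕ.+ length (layer (suc j))
    reached-suc j = filter-split (reaches? (suc j)) (reaches? j) inj₁ states

    reached≤ : ∀ j → reached j ℕ.≤ ∣V∣ ℕ.* 2
    reached≤ j = ℕₚ.≤-trans (Listₚ.length-filter (reaches? j) states) (ℕₚ.≤-reflexive length-states)

    sinks-reach : ∀ j {x} → Reaches zero x → Reaches j x
    sinks-reach zero r = r
    sinks-reach (suc j) r = inj₁ (sinks-reach j r)

    arcs-unique : Unique (map edge arcs)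
    arcs-unique = subst Unique (sym covers) (Uniqueₚ.filter⁺ differ? (Uniqueₚ.allFin⁺ ∣E∣))

    -- If the target were closer than `j`, the source would lie in the ball of radius `j` as well.
    entering-layers : ∀ j {a} → a ∈ arcs → Enters (reaches? j) a → Layer (suc j) (source a) × Layer j (target a)
    entering-layers j {a} a∈ (t , ¬s) = (inj₂ (lose a∈ (refl , t)) , ¬s) , target-layer j t ¬s
      where
      target-layer : ∀ j → Reaches j (target a) → ¬ Reaches j (source a) → Layer j (target a)
      target-layer zero t _ = t
      target-layer (suc j) t ¬s = t , λ t′ → ¬s (inj₂ (lose a∈ (refl , t′)))

    -- In a simple graph tail and head determine the edge, and each edge has only one arc, so an
    -- entering arc is determined by its pair of end states.
    entering≤ : ∀ j → length (filter (enters? (reaches? j)) arcs) ℕ.≤ length (layer (suc j)) ℕ.* length (layer j)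
    entering≤ j = begin
      length entering                        ≡⟨ Listₚ.length-map endStates entering ⟨
      length (map endStates entering)        ≤⟨ Unique-⊆-length unique within ⟩
      length (cartesianProduct (layer (suc j)) (layer j)) ≡⟨ length-cartesianProduct (layer (suc j)) (layer j) ⟩
      _ ∎
      where
      open ℕₚ.≤-Reasoning
      entering = filter (enters? (reaches? j)) arcs
      endStates : Arc → State × State
      endStates a = source a , target a
      same-edge : ∀ {a b} → endStates a ≡ endStates b → edge a ≡ edge b
      same-edge {arc _ _ _ p} {arc _ _ _ q} eq with cong (proj₁ ∘ proj₁) eq | cong (proj₁ ∘ proj₂) eq
      ... | refl | refl = simple p q
      unique : Unique (map endStates entering)
      unique = AllPairsₚ.map⁺ (AllPairs.map (λ {a} {b} e≢ → e≢ ∘ same-edge {a} {b}) (AllPairsₚ.filter⁺ (enters? (reaches? j)) (AllPairsₚ.map⁻ arcs-unique)))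
      within : ∀ {p} → p ∈ map endStates entering → p ∈ cartesianProduct (layer (suc j)) (layer j)
      within p∈ with ∈-map⁻ endStates p∈
      ... | a , a∈ , refl with ∈-filter⁻ (enters? (reaches? j)) {xs = arcs} a∈
      ...   | a∈arcs , enters with entering-layers j a∈arcs enters
      ...     | s , t = ∈-cartesianProduct⁺ (∈-filter⁺ (layer? (suc j)) (∈-states _) s) (∈-filter⁺ (layer? j) (∈-states _) t)

    -- From routes to augmenting trails

    data Route (w : Vertex) : State → List Arc → Set where
      -- States are fixed by equations because `target a` contains `not (matched a)`, which does not
      -- unify with `true`.
      done : ∀ {x} → x ≡ (w , true) → Route w x []
      step : ∀ {x a as} → a ∈ arcs → source a ≡ x → Route w (target a) as → Route w x (a ∷ as)

    -- An arc is prepended only at a state not reached within `j` steps, while every arc behind it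
    -- starts at a state that is. Recording this bound on the sources keeps the edges distinct.
    route : ∀ j {x} → Reaches j x → ∃₂ λ w as → excess (w , true) < 0ℤ × Route w x as × length as ℕ.≤ j ×
            Unique (map edge as) × All (λ a → a ∈ arcs × Reaches j (source a)) as
    route zero {v , true} (refl , ex<0) = v , [] , ex<0 , done refl , z≤n , [] , []
    route (suc j) {x} r with reaches? j x
    ... | yes r′ with route j r′
    ...   | w , as , ex<0 , rt , len , u , all = w , as , ex<0 , rt , ℕₚ.m≤n⇒m≤1+n len , u , All.map (λ (a∈ , r) → a∈ , inj₁ r) all
    route (suc j) {x} (inj₁ r) | no ¬r = contradiction r ¬r
    route (suc j) {x} (inj₂ r) | no ¬r with find r
    ... | a , a∈ , refl , ra with route j ra
    ...   | w , as , ex<0 , rt , len , u , all =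
      w , a ∷ as , ex<0 , step a∈ refl rt , s≤s len , fresh ∷ u , (a∈ , inj₂ r) ∷ All.map (λ (b∈ , r) → b∈ , inj₁ r) all
      where
      -- Every edge has a single arc, so a repeated edge would have to be left from the same state
      -- `source a`.
      fresh : All (edge a ≢_) (map edge as)
      fresh = Allₚ.map⁺ (All.map (λ { (b∈ , rb) eq → ¬r (subst (Reaches j ∘ source) (sym (Unique-map-injective arcs-unique a∈ b∈ eq)) rb) }) all)

    walk : ∀ {w x as} → Route w x as → Walk (proj₁ x) w
    walk (done refl) = []
    walk (step {a = a} _ refl r) = edge a ∷⟨ joins a ⟩ walk r

    walkEdges-walk : ∀ {w x as} (r : Route w x as) → walkEdges (walk r) ≡ map edge as
    walkEdges-walk (done refl) = refl
    walkEdges-walk (step {a = a} _ refl r) = cong (edge a ∷_) (walkEdges-walk r)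

    ∈M : ∀ {e} → lookup M e ≡ true → e Subset.∈ M
    ∈M {e} eq = Vecₚ.lookup⇒[]= e M eq

    ∉M : ∀ {e} → lookup M e ≡ false → e Subset.∉ M
    ∉M eq e∈ = contradiction (trans (sym eq) (Vecₚ.[]=⇒lookup e∈)) λ ()

    -- The target of an arc is the source of the next one, and `target` negates `matched`.
    alternating : ∀ {w x as} → Route w x as → Linked (λ e e′ → (e Subset.∈ M × e′ Subset.∉ M) ⊎ (e Subset.∉ M × e′ Subset.∈ M)) (map edge as)
    alternating (done _) = []
    alternating (step _ _ (done _)) = [-]
    alternating (step {a = a} _ _ r@(step {a = b} _ eq _)) = link (matched a) refl (cong proj₂ eq) ∷ alternating r
      where
      link : ∀ m → matched a ≡ m → matched b ≡ not (matched a) → (edge a Subset.∈ M × edge b Subset.∉ M) ⊎ (edge a Subset.∉ M × edge b Subset.∈ M)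
      link true ma mb = inj₁ (∈M ma , ∉M (trans mb (cong not ma)))
      link false ma mb = inj₂ (∉M ma , ∈M (trans mb (cong not ma)))

    first-unmatched : ∀ {w u as} → Route w (u , false) as → Maybe.Any (Subset._∉ M) (List.head (map edge as))
    first-unmatched (done ())
    first-unmatched (step _ eq _) = just (∉M (cong proj₂ eq))

    last-unmatched : ∀ {w u as} → Route w (u , false) as → Maybe.Any (Subset._∉ M) (List.last (map edge as))
    last-unmatched (done ())
    last-unmatched (step {a = a} _ _ r) = final a r
      where
      final : ∀ {w} a {as} → Route w (target a) as → Maybe.Any (Subset._∉ M) (List.last (map edge (a ∷ as)))
      final a (done eq) = just (∉M (Boolₚ.not-injective (cong proj₂ eq)))
      final _ (step {a = b} _ _ r) = final b r

    -- At a vertex passed through, the arriving and the leaving edge have opposite signs and cancel,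
    -- so only the two ends of the route remain.
    route-degree : ∀ {w x as} → Route w x as → ∀ v → ∑ (λ e → sign (lookup M e) * incidence e v) (map edge as) ≡ δ w v + sign (proj₂ x) * δ (proj₁ x) v
    -- An empty route starts at `(w , true)`, whose sign -1 cancels the +1 of the finish.
    route-degree {w} (done refl) v = lem (δ w v) where
      lem : ∀ d → 0ℤ ≡ d + -1ℤ * d
      lem = solve-∀
    route-degree {w} (step {a = a} _ refl r) v = trans (cong₂ _+_ (cong (sign (matched a) *_) (incidence-arc a v)) (route-degree r v))
      (lem (matched a) (δ w v) (δ (tail a) v) (δ (head a) v))
      where
      lem⁺ : ∀ w t h → 1ℤ * (t + h) + (w + -1ℤ * h) ≡ w + 1ℤ * t
      lem⁺ = solve-∀
      lem⁻ : ∀ w t h → -1ℤ * (t + h) + (w + 1ℤ * h) ≡ w + -1ℤ * t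
      lem⁻ = solve-∀
      lem : ∀ m w t h → sign m * (t + h) + (w + sign (not m) * h) ≡ w + sign m * t
      lem true = lem⁻
      lem false = lem⁺

    start-gap : ∀ v → 0ℤ < excess (v , false) → 1ℤ ≤ excess (v , false) - excess (v , true)
    start-gap v 0<ex = positive-gap (excess (v , false)) (excess (v , true)) 0<ex (excess-sum v)

    finish-gap : ∀ v → excess (v , true) < 0ℤ → 1ℤ ≤ excess (v , false) - excess (v , true)
    finish-gap v ex<0 = negative-gap (excess (v , false)) (excess (v , true)) ex<0 (excess-sum v)

    -- The gap is the degree in `N` minus that in `M`, and `N` respects `f`.
    room : ∀ {k} v → k ≤ excess (v , false) - excess (v , true) → + degree M v + k ≤ + f v
    room {k} v k≤ = begin
      + degree M v + k ≤⟨ ℤₚ.+-monoʳ-≤ (+ degree M v) k≤ ⟩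
      + degree M v + (excess (v , false) - excess (v , true)) ≡⟨ cong (_+_ (+ degree M v)) (excess-difference v) ⟩
      + degree M v + (+ degree N v - + degree M v) ≡⟨ lem (+ degree M v) (+ degree N v) ⟩
      + degree N v ≤⟨ +≤+ (isN v) ⟩
      + f v ∎
      where
      open ℤₚ.≤-Reasoning
      lem : ∀ m n → m + (n - m) ≡ n
      lem = solve-∀

    free : ∀ v → 1ℤ ≤ excess (v , false) - excess (v , true) → Free M v
    free v 1≤ = ℕₚ.≤-trans (ℕₚ.≤-reflexive (ℕₚ.+-comm 1 (degree M v))) (ℤₚ.drop‿+≤+ (room v 1≤))

    module _ {u w as} (0<ex : 0ℤ < excess (u , false)) (ex<0 : excess (w , true) < 0ℤ)
             (r : Route w (u , false) as) (unique : Unique (map edge as)) where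

      trail : Trail
      trail = record { start = u ; finish = w ; walk = walk r ; unique = subst Unique (sym (walkEdges-walk r)) unique }

      demand : ∀ v → + degree M v + (δ w v + 1ℤ * δ u v) ≤ + f v
      demand v with w Finₚ.≟ v | u Finₚ.≟ v
      -- A closed trail raises the degree of its end by 2. The two excess bounds add up to a gap of
      -- 2 there, whereas each gap lemma alone gives 1.
      ... | yes refl | yes refl = room v (ℤₚ.+-mono-≤ (ℤₚ.i<j⇒suc[i]≤j 0<ex) (ℤₚ.neg-mono-≤ (ℤₚ.i<j⇒i≤pred[j] ex<0)))
      ... | yes refl | no _ = room v (finish-gap v ex<0)
      ... | no _ | yes refl = room v (start-gap v 0<ex)
      ... | no _ | no _ = ℤₚ.≤-trans (ℤₚ.≤-reflexive (ℤₚ.+-identityʳ _)) (+≤+ (isM v))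

      augmenting : IsAugmenting M trail
      augmenting = record
        { alternating = subst (Linked _) (sym edges≡) (alternating r)
        ; startFree = free u (start-gap u 0<ex)
        ; finishFree = free w (finish-gap w ex<0)
        ; firstUnmatched = subst (Maybe.Any _ ∘ List.head) (sym edges≡) (first-unmatched r)
        ; lastUnmatched = subst (Maybe.Any _ ∘ List.last) (sym edges≡) (last-unmatched r)
        ; augmented = λ v → ℤₚ.drop‿+≤+ (ℤₚ.≤-trans (ℤₚ.≤-reflexive (change v)) (demand v))
        }
        where
        edges≡ = walkEdges-walk r
        change : ∀ v → + degree (M ⊕ Trail.edgeSet trail) v ≡ + degree M v + (δ w v + 1ℤ * δ u v)
        change v rewrite edges≡ = trans (degree-⊕ v unique) (cong (_+_ (+ degree M v)) (route-degree r v))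

    -- Cuts between layers

    module _ (s : ℕ) (shortest : ∀ B → IsAugmenting M B → s ℕ.≤ Trail.len B) where

      -- A positive excess would turn the route into an augmenting trail with at most `j` edges,
      -- fewer than `s`.
      start-unreached : ∀ {j v} → Reaches j (v , false) → j ℕ.< s → excess (v , false) ≤ 0ℤ
      start-unreached {j} {v} reaches j<s = ℤₚ.≮⇒≥ λ 0<ex → case route j reaches of λ
        { (w , as , ex<0 , r , len , u , _) → ℕₚ.<⇒≱ j<s (begin
            s ≤⟨ shortest (trail 0<ex ex<0 r u) (augmenting 0<ex ex<0 r u) ⟩
            length (walkEdges (walk r)) ≡⟨ cong length (walkEdges-walk r) ⟩
            length (map edge as) ≡⟨ Listₚ.length-map edge as ⟩
            length as ≤⟨ len ⟩
            j ∎) }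
        where open ℕₚ.≤-Reasoning

      -- The cut is taken at the ball of radius `j`, which contains all sinks and, as `j < s`, no
      -- start.
      layers-bound : ∀ {j} → j ℕ.< s → ∣ N ∣ ℕ.≤ ∣ M ∣ ℕ.+ length (layer (suc j)) ℕ.* length (layer j)
      layers-bound {j} j<s = ℤₚ.drop‿+≤+ (begin
        + ∣ N ∣ ≡⟨ lem (+ ∣ M ∣) (+ ∣ N ∣) ⟨
        + ∣ M ∣ + (+ ∣ N ∣ - + ∣ M ∣) ≤⟨ ℤₚ.+-monoʳ-≤ (+ ∣ M ∣) (cut (reaches? j) (λ v p → start-unreached p j<s)
          (λ v ¬p → ℤₚ.≮⇒≥ λ ex<0 → ¬p (sinks-reach j (refl , ex<0)))) ⟩
        + ∣ M ∣ + + length (filter (enters? (reaches? j)) arcs) ≤⟨ ℤₚ.+-monoʳ-≤ (+ ∣ M ∣) (+≤+ (entering≤ j)) ⟩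
        _ ∎)
        where
        open ℤₚ.≤-Reasoning
        lem : ∀ m n → m + (n - m) ≡ n
        lem = solve-∀

-- Numerical estimates

module Estimates where

  open import Data.Nat.Base using (_+_; _*_; _∸_; _≤_; _<_)
  open ℕₚ
  open ℕ-Solver using (solve-∀)
  import Data.Integer.Base as ℤ
  import Data.Rational.Base as ℚ

  -- The two sides differ by the square of `d`; the case distinction keeps `d` a natural number.
  4mn≤[m+n]² : ∀ m n → 4 * (m * n) ≤ (m + n) * (m + n)
  4mn≤[m+n]² m n with ≤-total m n
  ... | inj₁ m≤n = subst (λ n → 4 * (m * n) ≤ (m + n) * (m + n)) (m+[n∸m]≡n m≤n) (begin
    4 * (m * (m + d)) ≤⟨ m≤m+n _ (d * d) ⟩
    4 * (m * (m + d)) + d * d ≡⟨ lem m d ⟩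
    (m + (m + d)) * (m + (m + d)) ∎)
    where
    open ≤-Reasoning
    d = n ∸ m
    lem : ∀ m d → 4 * (m * (m + d)) + d * d ≡ (m + (m + d)) * (m + (m + d))
    lem = solve-∀
  ... | inj₂ n≤m = subst (λ m → 4 * (m * n) ≤ (m + n) * (m + n)) (m+[n∸m]≡n n≤m) (begin
    4 * ((n + d) * n) ≤⟨ m≤m+n _ (d * d) ⟩
    4 * ((n + d) * n) + d * d ≡⟨ lem n d ⟩
    ((n + d) + n) * ((n + d) + n) ∎)
    where
    open ≤-Reasoning
    d = m ∸ n
    lem : ∀ n d → 4 * ((n + d) * n) + d * d ≡ ((n + d) + n) * ((n + d) + n)
    lem = solve-∀

  module _ (l t : ℕ → ℕ) (n s : ℕ) .{{_ : NonZero s}} (t-zero : t 0 ≡ l 0) (t-suc : ∀ j → t (suc j) ≡ t j + l (suc j))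
           (t≤ : ∀ j → t j ≤ n * 2) where

    -- If the bound failed, then by the inequality of means any two consecutive layers up to layer
    -- `s` would together have more than `4n / s` states. Summed over `j < s` this exceeds `4n`,
    -- although the sum counts each of at most `2n` states at most twice.
    product-bound : ∀ {k} → (∀ {j} → j < s → k ≤ l (suc j) * l j) → k * (s * s) ≤ 4 * (n * n)
    product-bound {k} k≤ = ≮⇒≥ λ big → <-irrefl refl (begin-strict
      s * (4 * n)             <⟨ *-monoʳ-< s (n<1+n (4 * n)) ⟩
      s * suc (4 * n)         ≤⟨ m≤m+n _ (s * l s) ⟩
      s * suc (4 * n) + s * l s ≤⟨ telescope big s ≤-refl ⟩
      s * (2 * t s)           ≤⟨ *-monoʳ-≤ s (*-monoʳ-≤ 2 (t≤ s)) ⟩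
      s * (2 * (n * 2))       ≡⟨ lem s n ⟩
      s * (4 * n)             ∎)
      where
      open ≤-Reasoning
      lem : ∀ s n → s * (2 * (n * 2)) ≡ s * (4 * n)
      lem = solve-∀

      -- Multiplying by `s` avoids division; the comparison is made between the squares of both
      -- sides.
      wide : 4 * (n * n) < k * (s * s) → ∀ {j} → j < s → suc (4 * n) ≤ s * (l (suc j) + l j)
      wide big {j} j<s = ≰⇒> λ narrow → <-irrefl refl (begin-strict
        4 * (4 * (n * n))                        <⟨ *-monoʳ-< 4 big ⟩
        4 * (k * (s * s))                        ≤⟨ *-monoʳ-≤ 4 (*-monoˡ-≤ (s * s) (k≤ j<s)) ⟩
        4 * (l (suc j) * l j * (s * s))          ≡⟨ *-assoc 4 (l (suc j) * l j) (s * s) ⟨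
        4 * (l (suc j) * l j) * (s * s)          ≤⟨ *-monoˡ-≤ (s * s) (4mn≤[m+n]² (l (suc j)) (l j)) ⟩
        (l (suc j) + l j) * (l (suc j) + l j) * (s * s) ≡⟨ square (l (suc j) + l j) s ⟩
        s * (l (suc j) + l j) * (s * (l (suc j) + l j)) ≤⟨ *-mono-≤ narrow narrow ⟩
        4 * n * (4 * n)                          ≡⟨ quad n ⟩
        4 * (4 * (n * n))                        ∎)
        where
        square : ∀ w s → w * w * (s * s) ≡ s * w * (s * w)
        square = solve-∀
        quad : ∀ n → 4 * n * (4 * n) ≡ 4 * (4 * (n * n))
        quad = solve-∀

      -- The pairs up to layer `j > 0` count that layer once, while `2 * t j` counts it twice; the
      -- term `s * l j` reserves the other half for the next pair.
      telescope : 4 * (n * n) < k * (s * s) → ∀ j → j ≤ s → j * suc (4 * n) + s * l j ≤ s * (2 * t j)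
      telescope big zero _ = *-monoʳ-≤ s (≤-trans (≤-reflexive (sym t-zero)) (m≤m+n (t 0) _))
      telescope big (suc j) j<s = begin
        suc j * suc (4 * n) + s * l (suc j) ≡⟨ shift (suc (4 * n)) j (s * l (suc j)) ⟩
        suc (4 * n) + (j * suc (4 * n) + s * l (suc j)) ≤⟨ +-monoˡ-≤ _ (wide big j<s) ⟩
        s * (l (suc j) + l j) + (j * suc (4 * n) + s * l (suc j)) ≡⟨ regroup s (l (suc j)) (l j) (j * suc (4 * n)) ⟩
        (j * suc (4 * n) + s * l j) + s * (2 * l (suc j)) ≤⟨ +-monoˡ-≤ _ (telescope big j (<⇒≤ j<s)) ⟩
        s * (2 * t j) + s * (2 * l (suc j)) ≡⟨ collect s (t j) (l (suc j)) ⟩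
        s * (2 * (t j + l (suc j))) ≡⟨ cong (λ t → s * (2 * t)) (t-suc j) ⟨
        s * (2 * t (suc j)) ∎
        where
        shift : ∀ c j x → suc j * c + x ≡ c + (j * c + x)
        shift = solve-∀
        regroup : ∀ s l′ l c → s * (l′ + l) + (c + s * l′) ≡ (c + s * l) + s * (2 * l′)
        regroup = solve-∀
        collect : ∀ s t l → s * (2 * t) + s * (2 * l) ≡ s * (2 * (t + l))
        collect = solve-∀

  -- On rationals `_/_` reduces fractions, so the inequality is moved to unnormalised ones, where it
  -- is a cross-multiplication.
  ratio-bound : ∀ N M n s .{{_ : NonZero s}} → (N ∸ M) * (s * s) ≤ 4 * (n * n) →
    + N ℚ./ 1 ℚ.≤ + M ℚ./ 1 ℚ.+ (+ 4 ℚ./ 1) ℚ.* ((+ n ℚ./ s) ℚ.* (+ n ℚ./ s))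
  ratio-bound N M n s@(suc s-1) bound = ℚₚ.toℚᵘ-cancel-≤ (begin
    ℚ.toℚᵘ (+ N ℚ./ 1) ≃⟨ ℚₚ.toℚᵘ-fromℚᵘ (ℚᵘ.mkℚᵘ (+ N) 0) ⟩
    ℚᵘ.mkℚᵘ (+ N) 0 ≤⟨ ℚᵘ.*≤* (subst₂ ℤ._≤_ lhs rhs (ℤ.+≤+ cross)) ⟩
    ℚᵘ.mkℚᵘ (+ M) 0 ℚᵘ.+ ℚᵘ.mkℚᵘ (+ 4) 0 ℚᵘ.* (ℚᵘ.mkℚᵘ (+ n) s-1 ℚᵘ.* ℚᵘ.mkℚᵘ (+ n) s-1)
      ≃⟨ ℚᵘₚ.+-cong (ℚₚ.toℚᵘ-fromℚᵘ (ℚᵘ.mkℚᵘ (+ M) 0)) (ℚᵘₚ.*-cong (ℚₚ.toℚᵘ-fromℚᵘ (ℚᵘ.mkℚᵘ (+ 4) 0))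
           (ℚᵘₚ.*-cong (ℚₚ.toℚᵘ-fromℚᵘ (ℚᵘ.mkℚᵘ (+ n) s-1)) (ℚₚ.toℚᵘ-fromℚᵘ (ℚᵘ.mkℚᵘ (+ n) s-1)))) ⟨
    ℚ.toℚᵘ (+ M ℚ./ 1) ℚᵘ.+ ℚ.toℚᵘ (+ 4 ℚ./ 1) ℚᵘ.* (ℚ.toℚᵘ n/s ℚᵘ.* ℚ.toℚᵘ n/s)
      ≃⟨ ℚᵘₚ.+-congʳ (ℚ.toℚᵘ (+ M ℚ./ 1)) (ℚᵘₚ.≃-trans (ℚₚ.toℚᵘ-homo-* (+ 4 ℚ./ 1) (n/s ℚ.* n/s)) (ℚᵘₚ.*-congˡ {ℚ.toℚᵘ (+ 4 ℚ./ 1)} (ℚₚ.toℚᵘ-homo-* n/s n/s))) ⟨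
    ℚ.toℚᵘ (+ M ℚ./ 1) ℚᵘ.+ ℚ.toℚᵘ ((+ 4 ℚ./ 1) ℚ.* (n/s ℚ.* n/s))
      ≃⟨ ℚₚ.toℚᵘ-homo-+ (+ M ℚ./ 1) ((+ 4 ℚ./ 1) ℚ.* (n/s ℚ.* n/s)) ⟨
    ℚ.toℚᵘ (+ M ℚ./ 1 ℚ.+ (+ 4 ℚ./ 1) ℚ.* (n/s ℚ.* n/s)) ∎)
    where
    open ℚᵘₚ.≤-Reasoning
    n/s = + n ℚ./ s
    -- The factors 1 are denominators as the unnormalised operations produce them. Truncation is
    -- harmless since `N ≤ M + (N ∸ M)` always holds.
    cross : N * (1 * (1 * (s * s))) ≤ (M * (1 * (s * s)) + 4 * (n * n) * 1) * 1
    cross = ≤-trans (*-monoˡ-≤ (1 * (1 * (s * s))) (m≤n+m∸n N M)) (≤-trans (≤-reflexive (expand M (N ∸ M) s))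
      (≤-trans (+-monoʳ-≤ (M * (s * s)) bound) (≤-reflexive (contract M n s))))
      where
      expand : ∀ M k s → (M + k) * (1 * (1 * (s * s))) ≡ M * (s * s) + k * (s * s)
      expand = solve-∀
      contract : ∀ M n s → M * (s * s) + 4 * (n * n) ≡ (M * (1 * (s * s)) + 4 * (n * n) * 1) * 1
      contract = solve-∀
    lhs : + (N * (1 * (1 * (s * s)))) ≡ + N ℤ.* + (1 * (1 * (s * s)))
    lhs = ℤₚ.pos-* N _
    rhs : + ((M * (1 * (s * s)) + 4 * (n * n) * 1) * 1) ≡ (+ M ℤ.* + (1 * (s * s)) ℤ.+ (+ 4 ℤ.* (+ n ℤ.* + n)) ℤ.* + 1) ℤ.* + 1
    rhs = trans (ℤₚ.pos-* (M * (1 * (s * s)) + 4 * (n * n) * 1) 1) (cong (ℤ._* + 1)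
      (cong₂ ℤ._+_ (ℤₚ.pos-* M _) (trans (ℤₚ.pos-* (4 * (n * n)) 1) (cong (ℤ._* + 1) (trans (ℤₚ.pos-* 4 (n * n)) (cong (+ 4 ℤ.*_) (ℤₚ.pos-* n n)))))))

-- Invariant of the algorithm and conclusion

rounds-matching : (G : Graph) (let open Graph G) (f : Vertex → ℕ) (let open Matching f) →
  ∀ {M M′} → IsMatching M → Star Round M M′ → IsMatching M′
rounds-matching G f isM ε = isM
rounds-matching G f _ (Graph.Matching.round _ _ blocking ◅ rounds) =
  -- A collection comes with a proof that augmenting all its trails gives an f-matching, so each
  -- round re-establishes the invariant.
  rounds-matching G f (IsCollection.augmented (IsBlocking.collection blocking)) rounds
  where open Graph.Matching G f

reached-matching : (G : Graph) (let open Graph G) (f : Vertex → ℕ) (let open Matching f) →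
  ∀ {M} → Reached M → IsMatching M
reached-matching G f (_ , isM₀ , rounds) = rounds-matching G f isM₀ rounds

open import Data.Rational.Base using (_/_; _+_; _*_; _≤_)

mainTheorem2 : (G : Graph) (let open Graph G) → Simple →
    (f : Vertex → ℕ) (let open Matching f) →
    (M : Edges) → Reached M →
    (A : Trail) (short : IsShortestAugmenting M A) →
    (let instance _ = len-nonZero short) →
    (let n/s = + ∣V∣ / Trail.len A) →
    (N : Edges) → IsMatching N →
    + ∣ N ∣ / 1 ≤ + ∣ M ∣ / 1 + (+ 4 / 1) * (n/s * n/s)
mainTheorem2 G simple f M reachedM A short N isN =
  ratio-bound ∣ N ∣ ∣ M ∣ ∣V∣ (Trail.len A)
    -- Layer sizes and ball sizes serve as `l` and `t`; `refl` suffices because the ball of radius 0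
    -- is layer 0 by definition. The number `k` is the truncated difference of the sizes of `N` and
    -- `M`.
    (product-bound (length ∘ layer) reached ∣V∣ (Trail.len A) refl reached-suc reached≤
      λ j<s → ℕₚ.m≤n+o⇒m∸n≤o ∣ N ∣ ∣ M ∣ (layers-bound (Trail.len A) (IsShortestAugmenting.minimal short) j<s))
  where
  open Graph G
  open Matching f
  open Estimates
  open Flow G simple f M N (reached-matching G f reachedM) isN
  open Directed oriented
  instance _ = len-nonZero short
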